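{- Let $D=(V(D),A(D),w)$ be a weighted digraph and let $G=UG(D)$ be its weighted underlying graph. (a) Suppose $|V(D)|\ge 2$ and let $k$ be the minimum of $w(X,Y)$ over all partitions $(X,Y)$ of $V(D)$ into two nonempty parts. Then $r^+(D)+k\le \mathrm{mac}(D)$. (b) $\frac{\mathrm{mac}(G)}{2}\le \mathrm{mac}(D)\le \frac{\mathrm{mac}(G)+r^+(D)}{2}$. (c) $\frac{\mathrm{mac}(G)/2+r^+(D)}{2}\le \mathrm{mac}(D)\le \frac{\mathrm{mac}(G)+r^+(D)}{2}$. (d) Let $\chi$ be the chromatic number of $G$. If $\chi$ is even then $\left(\frac14+\frac{1}{4(\chi-1)}\right)w(D)\le \mathrm{mac}(D)$, and if $\chi$ is odd then $\left(\frac14+\frac{1}{4\chi}\right)w(D)\le\mathrm{mac}(D)$.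
   Context: A weighted digraph $D=(V(D),A(D),w)$ is a digraph without loops or parallel arcs (a pair of opposite arcs $xy,yx$ is allowed) together with a weight function $w:A(D)\to\mathbb{R}_{\ge 0}$; for a subgraph $H$, $w(H)$ is the sum of the weights of its arcs. For a partition $(X,Y)$ of $V(D)$, the directed cut (dicut) $(X,Y)$ consists of the arcs going from $X$ to $Y$, and $w(X,Y)$ is their total weight. $\mathrm{mac}(D)$ is the maximum of $w(X,Y)$ over all partitions $(X,Y)$ of $V(D)$. For a weighted undirected graph $G$, $\mathrm{mac}(G)$ is the maximum total weight of edges with one end in $X$ and the other in $Y$, over partitions $(X,Y)$ of $V(G)$. The underlying graph $UG(D)$ has vertex set $V(D)$, with $x,y$ adjacent iff there is an arc between them; the edge weight is $w(xy)$ if only $xy\in A(D)$ and $w(xy)+w(yx)$ if both $xy,yx\in A(D)$. For $v\in V(D)$, $w^+(v)$ ($w^-(v)$) is the total weight of arcs leaving (entering) $v$, $r(v)=w^+(v)-w^-(v)$, and $r^+(D)=\sum_{r(x)>0}r(x)=\frac12\sum_{x\in V(D)}|r(x)|$. -}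

module Defs where

open import Level using (Level; _⊔_) renaming (suc to lsuc)
open import Algebra.Bundles using (CommutativeRing)
open import Algebra.Structures using (IsCommutativeRing)
open import Data.Bool.Base using (Bool; true; false; T; _∧_; _∨_; if_then_else_)
open import Data.Bool.Properties using (∨-comm; ∨-idem)
open import Data.Fin.Base using (Fin)
open import Data.Fin.Subset using (Subset; Nonempty; inside; outside; ∁; ⊥)
open import Data.List.Base using (List; map; _++_) renaming ([] to []ᴸ; _∷_ to _∷ᴸ_)
open import Data.Nat.Base using (ℕ; zero; suc) renaming (_≤_ to _≤ℕ_)
open import Data.Product.Base using (∃-syntax; Σ-syntax; _×_; _,_)
open import Data.Unit.Base using (tt)
open import Data.Vec.Base using ([]; _∷_; lookup)
open import Relation.Binary.Bundles using (DecTotalOrder; StrictTotalOrder)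
open import Relation.Binary.Core using (Rel)
open import Relation.Binary.PropositionalEquality.Core using (_≡_; _≢_; subst)
open import Relation.Binary.Structures using (IsDecTotalOrder)
open import Relation.Nullary using (¬_; does)

import Algebra.Properties.CommutativeMonoid.Sum as Sum
import Algebra.Properties.Monoid.Mult as Mult
import Data.List.Extrema as Extrema
import Relation.Binary.Properties.DecTotalOrder as DecTotalOrderProperties

-- The real numbers enter only through the axioms of a linearly ordered field
-- (with the decidable comparisons that ℝ has classically), so weights are
-- taken in an arbitrary such field; ℝ is an instance.  The value of 0# ⁻¹ is
-- unconstrained.
record OrderedField (c ℓ₁ ℓ₂ : Level) : Set (lsuc (c ⊔ ℓ₁ ⊔ ℓ₂)) where
  infix  8 _⁻¹
  infix  8 -_
  infixl 7 _*_ _/_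
  infixl 6 _+_
  infix  4 _≈_ _≤_
  field
    Carrier           : Set c
    _≈_               : Rel Carrier ℓ₁
    _≤_               : Rel Carrier ℓ₂
    _+_ _*_           : Carrier → Carrier → Carrier
    -_                : Carrier → Carrier
    0# 1#             : Carrier
    _⁻¹               : Carrier → Carrier
    isCommutativeRing : IsCommutativeRing _≈_ _+_ _*_ -_ 0# 1#
    isDecTotalOrder   : IsDecTotalOrder _≈_ _≤_
    1≉0               : ¬ (1# ≈ 0#)
    ⁻¹-inverse        : ∀ x → ¬ (x ≈ 0#) → (x * x ⁻¹) ≈ 1#
    +-mono-≤          : ∀ {x y u v} → x ≤ y → u ≤ v → (x + u) ≤ (y + v)
    *-nonneg          : ∀ {x y} → 0# ≤ x → 0# ≤ y → 0# ≤ (x * y)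

  commutativeRing : CommutativeRing c ℓ₁
  commutativeRing = record { isCommutativeRing = isCommutativeRing }

  decTotalOrder : DecTotalOrder c ℓ₁ ℓ₂
  decTotalOrder = record { isDecTotalOrder = isDecTotalOrder }

  open CommutativeRing commutativeRing public
    using (_-_; +-commutativeMonoid; +-monoid; +-comm; +-identityˡ)
  open DecTotalOrder decTotalOrder public
    using (totalOrder; ≤-respˡ-≈)
    renaming (refl to ≤-refl)
  open DecTotalOrderProperties decTotalOrder public
    using (_<_; <-strictTotalOrder)
  open StrictTotalOrder <-strictTotalOrder public using (_<?_)
  open Sum +-commutativeMonoid public using (sum)
  open Extrema totalOrder public using (max)

  _/_ : Carrier → Carrier → Carrier
  x / y = x * y ⁻¹

  fromℕ : ℕ → Carrier
  fromℕ m = Mult._×_ +-monoid m 1#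

allSubsets : ∀ n → List (Subset n)
allSubsets zero    = [] ∷ᴸ []ᴸ
allSubsets (suc n) = map (inside ∷_) (allSubsets n) ++ map (outside ∷_) (allSubsets n)

module _ {c ℓ₁ ℓ₂ : Level} (F : OrderedField c ℓ₁ ℓ₂) where
  open OrderedField F

  record WeightedDigraph (n : ℕ) : Set (c ⊔ ℓ₂) where
    field
      arc : Fin n → Fin n → Bool

    Arc : Fin n → Fin n → Set
    Arc x y = T (arc x y)

    field
      loopless : ∀ x → ¬ Arc x x
      w        : ∀ {x y} → Arc x y → Carrier
      w-nonneg : ∀ {x y} (a : Arc x y) → 0# ≤ w a

  record WeightedGraph (n : ℕ) : Set (c ⊔ ℓ₁ ⊔ ℓ₂) where
    field
      edge : Fin n → Fin n → Bool

    Edge : Fin n → Fin n → Set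
    Edge x y = T (edge x y)

    field
      edge-sym : ∀ x y → edge x y ≡ edge y x
      loopless : ∀ x → ¬ Edge x x
      w        : ∀ {x y} → Edge x y → Carrier
      w-sym    : ∀ {x y} (e : Edge x y) (e′ : Edge y x) → w e ≈ w e′
      w-nonneg : ∀ {x y} (e : Edge x y) → 0# ≤ w e

module _ {c ℓ₁ ℓ₂ : Level} {F : OrderedField c ℓ₁ ℓ₂} where
  open OrderedField F

  extendByZero : (b : Bool) → (T b → Carrier) → Carrier
  extendByZero true  f = f tt
  extendByZero false f = 0#

  extendByZero-nonneg : ∀ b {f} → (∀ t → 0# ≤ f t) → 0# ≤ extendByZero b f
  extendByZero-nonneg true  f≥0 = f≥0 tt
  extendByZero-nonneg false f≥0 = ≤-refl

  sumBetween : ∀ {n} → (Fin n → Fin n → Carrier) → Subset n → Subset n → Carrier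
  sumBetween f X Y = sum λ x → sum λ y →
    if lookup X x ∧ lookup Y y then f x y else 0#

  module _ {n : ℕ} (D : WeightedDigraph F n) where
    open WeightedDigraph D

    arcWeight : Fin n → Fin n → Carrier
    arcWeight x y = extendByZero (arc x y) w

    totalWeight : Carrier
    totalWeight = sum λ x → sum λ y → arcWeight x y

    -- A partition (X , Y) of the vertex set is given by X, with Y = ∁ X.
    dicutWeight : Subset n → Carrier
    dicutWeight X = sumBetween arcWeight X (∁ X)

    macᴰ : Carrier
    macᴰ = max (dicutWeight ⊥) (map dicutWeight (allSubsets n))

    IsMinProperDicut : Carrier → Set (ℓ₁ ⊔ ℓ₂)
    IsMinProperDicut k =
      (∃[ X ] (Nonempty X × Nonempty (∁ X) × dicutWeight X ≈ k)) ×
      (∀ X → Nonempty X → Nonempty (∁ X) → k ≤ dicutWeight X)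

    w⁺ w⁻ r : Fin n → Carrier
    w⁺ v = sum λ y → arcWeight v y
    w⁻ v = sum λ x → arcWeight x v
    r v = w⁺ v - w⁻ v

    r⁺ : Carrier
    r⁺ = sum λ x → if does (0# <? r x) then r x else 0#

    -- The weight of an edge is w(xy) + w(yx), where an absent arc counts 0.
    UG : WeightedGraph F n
    UG = record
      { edge     = λ x y → arc x y ∨ arc y x
      ; edge-sym = λ x y → ∨-comm (arc x y) (arc y x)
      ; loopless = λ x e → loopless x (subst T (∨-idem (arc x x)) e)
      ; w        = λ {x} {y} _ → arcWeight x y + arcWeight y x
      ; w-sym    = λ {x} {y} _ _ → +-comm (arcWeight x y) (arcWeight y x)
      ; w-nonneg = λ {x} {y} _ →
          ≤-respˡ-≈ (+-identityˡ 0#)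
            (+-mono-≤ (extendByZero-nonneg (arc x y) w-nonneg)
                      (extendByZero-nonneg (arc y x) w-nonneg))
      }

  module _ {n : ℕ} (G : WeightedGraph F n) where
    open WeightedGraph G

    edgeWeight : Fin n → Fin n → Carrier
    edgeWeight x y = extendByZero (edge x y) w

    -- Each edge across the cut is counted once, from its end in X.
    cutWeight : Subset n → Carrier
    cutWeight X = sumBetween edgeWeight X (∁ X)

    macᴳ : Carrier
    macᴳ = max (cutWeight ⊥) (map cutWeight (allSubsets n))

    Colourable : ℕ → Set
    Colourable q = Σ[ f ∈ (Fin n → Fin q) ] (∀ x y → Edge x y → f x ≢ f y)

    IsChromaticNumber : ℕ → Set
    IsChromaticNumber χ = Colourable χ × (∀ q → Colourable q → χ ≤ℕ q)

{-# OPTIONS --safe #-}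
module Submission where

-- For every vertex set X, w(X, ∁X) − w(∁X, X) is the sum of r over X, hence at most r⁺, with
-- equality for X = {r > 0}.  Together with mac(G) = max (w(X, ∁X) + w(∁X, X)) this gives (a) and
-- (b), and the lower bound in (c) is the average of mac(G)/2 ≤ mac(D) and r⁺ ≤ mac(D).
--
-- For (d), colour G with 2k + 2 colours and sum the dicuts induced by all sets of k + 1 colours.
-- Each arc lies in C(2k, k) of these C(2k + 2, k + 1) dicuts, and the ratio of the two binomial
-- coefficients is (k + 1) / (2 (2k + 1)) = 1/4 + 1/(4 (2k + 1)).  An odd χ = 2k + 1 is treated by
-- allowing one further, unused colour.

open import Defs
open import Data.Nat.Base using (ℕ) renaming (_≤_ to _≤ℕ_)
open import Data.Nat.Divisibility.Core using (_∣_)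
open import Data.Product.Base using (_×_)
open import Relation.Nullary using (¬_)

open import Algebra.Bundles using (CommutativeRing)
open import Data.Bool.Base using (Bool; true; false; T; not; _∧_; _∨_; if_then_else_)
open import Data.Bool.Properties using (T-∨; ∧-comm; ∧-identityʳ; ∧-zeroʳ; not-involutive)
open import Data.Fin.Base using (Fin; zero; suc)
open import Data.Fin.Properties using (suc-injective)
open import Data.Fin.Subset using (Subset; Nonempty; Empty; inside; outside; ∁; ⊥)
open import Data.Fin.Subset.Properties using (nonempty?; x∉p⇒x∈∁p; x∈p⇒x∉∁p)
open import Data.List.Base using (map)
open import Data.List.Membership.Propositional using (_∈_)
open import Data.List.Membership.Propositional.Properties using (∈-++⁺ˡ; ∈-++⁺ʳ; ∈-map⁺)
open import Data.List.Relation.Unary.All as All using ()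
open import Data.List.Relation.Unary.All.Properties as All using ()
open import Data.List.Relation.Unary.Any using (here)
open import Data.Nat.Base as ℕ using (zero; suc; NonZero)
open import Data.Nat.Combinatorics using (_C_; nC1≡n; nCk≡nC[n∸k]; nCk+nC[k+1]≡[n+1]C[k+1])
open import Data.Nat.Divisibility.Core using (divides)
import Data.Nat.Properties as ℕ
open import Data.Nat.Solver using (module +-*-Solver)
open import Data.Product.Base using (∃-syntax; _,_)
open import Data.Sum.Base using (_⊎_; inj₁; inj₂)
open import Data.Unit.Base using (tt)
open import Data.Vec.Base using ([]; _∷_; lookup; tabulate)
open import Data.Vec.Properties using (lookup-map; lookup∘tabulate; lookup⇒[]=)
open import Function.Base using (_∘_; _$_)
open import Function.Bundles using (Equivalence)
open import Relation.Binary.Bundles using (DecTotalOrder)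
open import Relation.Binary.PropositionalEquality as ≡ using (_≡_; _≢_)
open import Relation.Nullary using (yes; no; does; contradiction)

import Algebra.Properties.Group as GroupProperties
import Algebra.Properties.Ring as RingProperties
import Algebra.Properties.Semiring.Mult as SemiringMult
import Algebra.Properties.Semiring.Sum as SemiringSum
import Algebra.Solver.Ring.NaturalCoefficients.Default as SemiringSolver
import Data.List.Extrema as Extrema
import Relation.Binary.Reasoning.Setoid as ≈-Reasoning

-- Enumeration of subsets, binomial coefficients and parity.

∈-allSubsets : ∀ {n} (X : Subset n) → X ∈ allSubsets n
∈-allSubsets []            = here ≡.refl
∈-allSubsets (inside  ∷ X) = ∈-++⁺ˡ (∈-map⁺ (inside ∷_) (∈-allSubsets X))
∈-allSubsets (outside ∷ X) = ∈-++⁺ʳ _ (∈-map⁺ (outside ∷_) (∈-allSubsets X))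

-- In Pascal's rule the summand `n C k` is already positive by induction. This permits cancelling
-- the central coefficient `(k + k) C k` at the end of the colouring argument.
nCk-nonZero : ∀ {n k} → k ≤ℕ n → NonZero (n C k)
nCk-nonZero {n}     {zero}  _           = _
nCk-nonZero {suc n} {suc k} (ℕ.s≤s k≤n) = ≡.subst NonZero (nCk+nC[k+1]≡[n+1]C[k+1] n k)
  (ℕ.>-nonZero (ℕ.<-≤-trans (ℕ.>-nonZero⁻¹ (n C k) ⦃ nCk-nonZero k≤n ⦄) (ℕ.m≤m+n (n C k) (n C suc k))))

-- The absorption identity. Pascal's rule splits the left side; after one copy of `c₁` is set aside,
-- the two induction hypotheses for `n` apply and a second use of Pascal's rule reassembles `c₁`.
[k+1]*[n+1]C[k+1]≡[n+1]*nCk : ∀ n k → suc k ℕ.* (suc n C suc k) ≡ suc n ℕ.* (n C k)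
[k+1]*[n+1]C[k+1]≡[n+1]*nCk zero    zero    = ≡.refl
[k+1]*[n+1]C[k+1]≡[n+1]*nCk zero    (suc k) = ℕ.*-zeroʳ (suc (suc k))
[k+1]*[n+1]C[k+1]≡[n+1]*nCk (suc n) zero    = begin
  1 ℕ.* (suc (suc n) C 1) ≡⟨ ≡.cong (1 ℕ.*_) (nC1≡n (suc (suc n))) ⟩
  1 ℕ.* suc (suc n)       ≡⟨ ℕ.*-comm 1 (suc (suc n)) ⟩
  suc (suc n) ℕ.* 1       ∎
  where open ≡.≡-Reasoning
[k+1]*[n+1]C[k+1]≡[n+1]*nCk (suc n) (suc k) = begin
  suc (suc k) ℕ.* (suc (suc n) C suc (suc k))
    ≡⟨ ≡.cong (suc (suc k) ℕ.*_) (nCk+nC[k+1]≡[n+1]C[k+1] (suc n) (suc k)) ⟨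
  suc (suc k) ℕ.* (c₁ ℕ.+ c₂)
    ≡⟨ solve 3 (λ k x y → (con 2 :+ k) :* (x :+ y) := x :+ ((con 1 :+ k) :* x :+ (con 2 :+ k) :* y)) ≡.refl k c₁ c₂ ⟩
  c₁ ℕ.+ (suc k ℕ.* c₁ ℕ.+ suc (suc k) ℕ.* c₂)
    ≡⟨ ≡.cong (c₁ ℕ.+_) (≡.cong₂ ℕ._+_ ([k+1]*[n+1]C[k+1]≡[n+1]*nCk n k) ([k+1]*[n+1]C[k+1]≡[n+1]*nCk n (suc k))) ⟩
  c₁ ℕ.+ (suc n ℕ.* (n C k) ℕ.+ suc n ℕ.* (n C suc k))
    ≡⟨ ≡.cong (c₁ ℕ.+_) (ℕ.*-distribˡ-+ (suc n) (n C k) (n C suc k)) ⟨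
  c₁ ℕ.+ suc n ℕ.* (n C k ℕ.+ n C suc k)
    ≡⟨ ≡.cong (λ z → c₁ ℕ.+ suc n ℕ.* z) (nCk+nC[k+1]≡[n+1]C[k+1] n k) ⟩
  suc (suc n) ℕ.* c₁ ∎
  where
  open ≡.≡-Reasoning
  open +-*-Solver
  c₁ c₂ : ℕ
  c₁ = suc n C suc k
  c₂ = suc n C suc (suc k)

-- The ratio of consecutive central binomial coefficients, free of division: two absorptions, linked
-- by the symmetry C(2k+1, k) = C(2k+1, k+1).
centralC-step : ∀ k → suc k ℕ.* ((2 ℕ.+ (k ℕ.+ k)) C suc k) ≡ 2 ℕ.* suc (k ℕ.+ k) ℕ.* ((k ℕ.+ k) C k)
-- The additional factor `suc k` is what the second absorption consumes.
centralC-step k = ℕ.*-cancelˡ-≡ _ _ (suc k) $ begin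
  suc k ℕ.* (suc k ℕ.* ((2 ℕ.+ (k ℕ.+ k)) C suc k))
    ≡⟨ ≡.cong (suc k ℕ.*_) ([k+1]*[n+1]C[k+1]≡[n+1]*nCk (suc (k ℕ.+ k)) k) ⟩
  suc k ℕ.* (suc (suc (k ℕ.+ k)) ℕ.* (suc (k ℕ.+ k) C k))
    ≡⟨ ≡.cong (λ z → suc k ℕ.* (suc (suc (k ℕ.+ k)) ℕ.* z)) symmetric ⟩
  suc k ℕ.* (suc (suc (k ℕ.+ k)) ℕ.* (suc (k ℕ.+ k) C suc k))
    ≡⟨ solve 2 (λ k x → (con 1 :+ k) :* ((con 2 :+ (k :+ k)) :* x) := (con 2 :+ (k :+ k)) :* ((con 1 :+ k) :* x))
         ≡.refl k (suc (k ℕ.+ k) C suc k) ⟩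
  suc (suc (k ℕ.+ k)) ℕ.* (suc k ℕ.* (suc (k ℕ.+ k) C suc k))
    ≡⟨ ≡.cong (suc (suc (k ℕ.+ k)) ℕ.*_) ([k+1]*[n+1]C[k+1]≡[n+1]*nCk (k ℕ.+ k) k) ⟩
  suc (suc (k ℕ.+ k)) ℕ.* (suc (k ℕ.+ k) ℕ.* ((k ℕ.+ k) C k))
    ≡⟨ solve 2 (λ k x → (con 2 :+ (k :+ k)) :* ((con 1 :+ (k :+ k)) :* x)
                     := (con 1 :+ k) :* (con 2 :* (con 1 :+ (k :+ k)) :* x)) ≡.refl k ((k ℕ.+ k) C k) ⟩
  suc k ℕ.* (2 ℕ.* suc (k ℕ.+ k) ℕ.* ((k ℕ.+ k) C k)) ∎
  where
  open ≡.≡-Reasoning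
  open +-*-Solver
  symmetric : suc (k ℕ.+ k) C k ≡ suc (k ℕ.+ k) C suc k
  symmetric = ≡.trans (nCk≡nC[n∸k] (ℕ.m≤n⇒m≤1+n (ℕ.m≤m+n k k)))
    (≡.cong (suc (k ℕ.+ k) C_) (ℕ.m+n∸n≡m (suc k) k))

even⊎odd : ∀ n → ∃[ k ] (n ≡ k ℕ.+ k ⊎ n ≡ suc (k ℕ.+ k))
even⊎odd zero    = 0 , inj₁ ≡.refl
even⊎odd (suc n) with even⊎odd n
... | k , inj₁ n≡k+k   = k , inj₂ (≡.cong suc n≡k+k)
... | k , inj₂ n≡1+k+k = suc k , inj₁ (≡.cong suc (≡.trans n≡1+k+k (≡.sym (ℕ.+-suc k k))))

m*2≡m+m : ∀ m → m ℕ.* 2 ≡ m ℕ.+ m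
m*2≡m+m m = ≡.trans (ℕ.*-comm m 2) (≡.cong (m ℕ.+_) (ℕ.+-identityʳ m))

-- Arithmetic of ordered fields and finite sums.

module OrderedFieldProperties {c ℓ₁ ℓ₂} (F : OrderedField c ℓ₁ ℓ₂) where
  open OrderedField F
  open CommutativeRing commutativeRing using
    ( setoid; refl; sym; trans; +-cong; +-congˡ; +-assoc; +-identityʳ; -‿cong;
      -‿inverseˡ; -‿inverseʳ; *-congˡ; *-congʳ; *-assoc; *-comm; *-identityˡ; distribˡ;
      distribʳ; zeroˡ; zeroʳ; ring; semiring )
  open DecTotalOrder decTotalOrder using (total; antisym)
    renaming (reflexive to ≤-reflexive; ≤-respʳ-≈ to ≤-respʳ)
  open RingProperties ring using (-‿distribˡ-*; -‿involutive)
  open SemiringMult semiring using (×-homo-+; ×1-homo-*; ×-homo-1)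
  open SemiringSum semiring using (sum-cong-≋; ∑-distrib-+; sum-replicate-zero)

  ≤-resp₂ : ∀ {x x′ y y′} → x ≈ x′ → y ≈ y′ → x ≤ y → x′ ≤ y′
  ≤-resp₂ x≈x′ y≈y′ = ≤-respˡ-≈ x≈x′ ∘ ≤-respʳ y≈y′

  *-monoˡ-≤ : ∀ {x y z} → 0# ≤ z → x ≤ y → z * x ≤ z * y
  *-monoˡ-≤ {x} {y} {z} 0≤z x≤y = ≤-resp₂ (+-identityˡ _) z[y-x]+zx≈zy (+-mono-≤ (*-nonneg 0≤z 0≤y-x) ≤-refl)
    where
    0≤y-x : 0# ≤ y + - x
    0≤y-x = ≤-respˡ-≈ (-‿inverseʳ x) (+-mono-≤ x≤y ≤-refl)
    z[y-x]+zx≈zy : z * (y + - x) + z * x ≈ z * y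
    z[y-x]+zx≈zy = begin
      z * (y + - x) + z * x ≈⟨ distribˡ z _ _ ⟨
      z * ((y + - x) + x)   ≈⟨ *-congˡ (+-assoc y (- x) x) ⟩
      z * (y + (- x + x))   ≈⟨ *-congˡ (+-congˡ (-‿inverseˡ x)) ⟩
      z * (y + 0#)          ≈⟨ *-congˡ (+-identityʳ y) ⟩
      z * y                 ∎
      where
      open ≈-Reasoning setoid

  -- If `1# ≤ 0#`, then `- 1#` is nonnegative, and so is its square, which is `1#`.
  0≤1 : 0# ≤ 1#
  0≤1 with total 0# 1#
  ... | inj₁ 0≤1 = 0≤1
  ... | inj₂ 1≤0 = ≤-respʳ [-1][-1]≈1 (*-nonneg 0≤-1 0≤-1)
    where
    0≤-1 : 0# ≤ - 1#
    0≤-1 = ≤-resp₂ (-‿inverseʳ 1#) (+-identityˡ _) (+-mono-≤ 1≤0 ≤-refl)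
    [-1][-1]≈1 : - 1# * - 1# ≈ 1#
    [-1][-1]≈1 = trans (sym (-‿distribˡ-* 1# (- 1#)))
      (trans (-‿cong (*-identityˡ (- 1#))) (-‿involutive 1#))

  fromℕ-nonneg : ∀ n → 0# ≤ fromℕ n
  fromℕ-nonneg zero    = ≤-refl
  fromℕ-nonneg (suc n) = ≤-respˡ-≈ (+-identityˡ 0#) (+-mono-≤ 0≤1 (fromℕ-nonneg n))

  -- Characteristic zero: a vanishing `fromℕ (suc n)` would give `1# ≤ 0#`, and with `0≤1` the
  -- excluded `1# ≈ 0#`.
  fromℕ≉0 : ∀ n .⦃ _ : NonZero n ⦄ → ¬ (fromℕ n ≈ 0#)
  fromℕ≉0 (suc n) 1+n≈0 = 1≉0 (antisym (≤-resp₂ (+-identityʳ 1#) 1+n≈0 (+-mono-≤ ≤-refl (fromℕ-nonneg n))) 0≤1)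

  *-cancelˡ-≈ : ∀ z {x y} → ¬ (z ≈ 0#) → z * x ≈ z * y → x ≈ y
  *-cancelˡ-≈ z {x} {y} z≉0 zx≈zy = trans (sym (undo x)) (trans (*-congˡ zx≈zy) (undo y))
    where
    undo : ∀ x → z ⁻¹ * (z * x) ≈ x
    undo x = trans (sym (*-assoc _ z x)) (trans (*-congʳ (trans (*-comm _ z) (⁻¹-inverse z z≉0))) (*-identityˡ x))

  -- The sign of the inverse never enters: if `y ≤ x`, monotonicity makes the two products equal,
  -- and equalities cancel.
  *-cancelˡ-≤ : ∀ n .⦃ _ : NonZero n ⦄ {x y} → fromℕ n * x ≤ fromℕ n * y → x ≤ y
  *-cancelˡ-≤ n {x} {y} nx≤ny with total x y
  ... | inj₁ x≤y = x≤y
  ... | inj₂ y≤x = ≤-reflexive (*-cancelˡ-≈ (fromℕ n) (fromℕ≉0 n) (antisym nx≤ny (*-monoˡ-≤ (fromℕ-nonneg n) y≤x)))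

  n*[x/n]≈x : ∀ n .⦃ _ : NonZero n ⦄ x → fromℕ n * (x / fromℕ n) ≈ x
  n*[x/n]≈x n x = begin
    N * (x * N ⁻¹) ≈⟨ *-congˡ (*-comm x _) ⟩
    N * (N ⁻¹ * x) ≈⟨ *-assoc N _ x ⟨
    (N * N ⁻¹) * x ≈⟨ *-congʳ (⁻¹-inverse N (fromℕ≉0 n)) ⟩
    1# * x         ≈⟨ *-identityˡ x ⟩
    x              ∎
    where
    open ≈-Reasoning setoid
    N = fromℕ n

  fromℕ-homo-+ : ∀ m n → fromℕ (m ℕ.+ n) ≈ fromℕ m + fromℕ n
  fromℕ-homo-+ = ×-homo-+ 1#

  fromℕ-homo-* : ∀ m n → fromℕ (m ℕ.* n) ≈ fromℕ m * fromℕ n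
  fromℕ-homo-* = ×1-homo-*

  2*x≈x+x : ∀ x → fromℕ 2 * x ≈ x + x
  2*x≈x+x x = trans (distribʳ x 1# (fromℕ 1))
    (+-cong (*-identityˡ x) (trans (*-congʳ (×-homo-1 1#)) (*-identityˡ x)))

  -- Unfolds to the conditional inside `sumBetween` and `r⁺`, so those sums are definitionally sums
  -- of `when` terms.
  when : Bool → Carrier → Carrier
  when b x = if b then x else 0#

  when-≡ : ∀ x {b b′} → b ≡ b′ → when b x ≈ when b′ x
  when-≡ x ≡.refl = refl

  when-cong : ∀ b {x y} → x ≈ y → when b x ≈ when b y
  when-cong true  x≈y = x≈y
  when-cong false _   = refl

  when-nonneg : ∀ b {x} → 0# ≤ x → 0# ≤ when b x
  when-nonneg true  0≤x = 0≤x
  when-nonneg false _   = ≤-refl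

  when-+ : ∀ b x y → when b (x + y) ≈ when b x + when b y
  when-+ true  x y = refl
  when-+ false x y = sym (+-identityˡ 0#)

  when-sum : ∀ b {n} (t : Fin n → Carrier) → when b (sum t) ≈ sum (λ i → when b (t i))
  when-sum true  t     = refl
  when-sum false {n} t = sym (sum-replicate-zero n)

  sum-mono : ∀ {n} {s t : Fin n → Carrier} → (∀ i → s i ≤ t i) → sum s ≤ sum t
  sum-mono {zero}  s≤t = ≤-refl
  sum-mono {suc n} s≤t = +-mono-≤ (s≤t zero) (sum-mono (s≤t ∘ suc))

  sum-nonneg : ∀ {n} {t : Fin n → Carrier} → (∀ i → 0# ≤ t i) → 0# ≤ sum t
  sum-nonneg {n} 0≤t = ≤-respˡ-≈ (sum-replicate-zero n) (sum-mono 0≤t)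

  sum≈0 : ∀ {n} {t : Fin n → Carrier} → (∀ i → t i ≈ 0#) → sum t ≈ 0#
  sum≈0 {n} t≈0 = trans (sum-cong-≋ t≈0) (sum-replicate-zero n)

  ∑∑-cong : ∀ {m n} {s t : Fin m → Fin n → Carrier} → (∀ i j → s i j ≈ t i j) →
            sum (λ i → sum (s i)) ≈ sum (λ i → sum (t i))
  ∑∑-cong s≈t = sum-cong-≋ λ i → sum-cong-≋ (s≈t i)

  ∑∑-distrib-+ : ∀ {m n} (s t : Fin m → Fin n → Carrier) →
                 sum (λ i → sum λ j → s i j + t i j) ≈ sum (λ i → sum (s i)) + sum (λ i → sum (t i))
  ∑∑-distrib-+ s t = trans (sum-cong-≋ λ i → ∑-distrib-+ (s i) (t i))
    (∑-distrib-+ (λ i → sum (s i)) (λ i → sum (t i)))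

  -- Sums over all subsets of a fixed size.

  sumOfSize : ∀ n → ℕ → (Subset n → Carrier) → Carrier
  sumOfSize zero    zero    g = g []
  sumOfSize zero    (suc p) g = 0#
  sumOfSize (suc n) zero    g = sumOfSize n zero (g ∘ (outside ∷_))
  -- Splitting on the first element mirrors Pascal's rule, so each count below reduces to `pascal`.
  sumOfSize (suc n) (suc p) g = sumOfSize n p (g ∘ (inside ∷_)) + sumOfSize n (suc p) (g ∘ (outside ∷_))

  sumOfSize-mono : ∀ n p {g h : Subset n → Carrier} → (∀ S → g S ≤ h S) → sumOfSize n p g ≤ sumOfSize n p h
  sumOfSize-mono zero    zero    g≤h = g≤h []
  sumOfSize-mono zero    (suc p) g≤h = ≤-refl
  sumOfSize-mono (suc n) zero    g≤h = sumOfSize-mono n zero (g≤h ∘ (outside ∷_))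
  sumOfSize-mono (suc n) (suc p) g≤h = +-mono-≤
    (sumOfSize-mono n p (g≤h ∘ (inside ∷_))) (sumOfSize-mono n (suc p) (g≤h ∘ (outside ∷_)))

  sumOfSize-cong : ∀ n p {g h : Subset n → Carrier} → (∀ S → g S ≈ h S) → sumOfSize n p g ≈ sumOfSize n p h
  sumOfSize-cong n p g≈h = antisym (sumOfSize-mono n p (≤-reflexive ∘ g≈h))
    (sumOfSize-mono n p (≤-reflexive ∘ sym ∘ g≈h))

  sumOfSize-sum : ∀ n p {m} (g : Fin m → Subset n → Carrier) →
                  sumOfSize n p (λ S → sum λ i → g i S) ≈ sum (λ i → sumOfSize n p (g i))
  sumOfSize-sum zero    zero    g     = refl
  sumOfSize-sum zero    (suc p) {m} g = sym (sum-replicate-zero m)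
  sumOfSize-sum (suc n) zero    g     = sumOfSize-sum n zero (λ i → g i ∘ (outside ∷_))
  sumOfSize-sum (suc n) (suc p) g     = trans
    (+-cong (sumOfSize-sum n p (λ i → g i ∘ (inside ∷_))) (sumOfSize-sum n (suc p) (λ i → g i ∘ (outside ∷_))))
    (sym (∑-distrib-+ (λ i → sumOfSize n p (g i ∘ (inside ∷_))) (λ i → sumOfSize n (suc p) (g i ∘ (outside ∷_)))))

  pascal : ∀ n k v → fromℕ (n C k) * v + fromℕ (n C suc k) * v ≈ fromℕ (suc n C suc k) * v
  pascal n k v = begin
    fromℕ (n C k) * v + fromℕ (n C suc k) * v ≈⟨ distribʳ v _ _ ⟨
    (fromℕ (n C k) + fromℕ (n C suc k)) * v   ≈⟨ *-congʳ (fromℕ-homo-+ (n C k) (n C suc k)) ⟨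
    fromℕ (n C k ℕ.+ n C suc k) * v           ≡⟨ ≡.cong (λ z → fromℕ z * v) (nCk+nC[k+1]≡[n+1]C[k+1] n k) ⟩
    fromℕ (suc n C suc k) * v                 ∎
    where
    open ≈-Reasoning setoid

  sumOfSize-const : ∀ n p v → sumOfSize n p (λ _ → v) ≈ fromℕ (n C p) * v
  sumOfSize-const zero    zero    v = sym (trans (*-congʳ (×-homo-1 1#)) (*-identityˡ v))
  sumOfSize-const zero    (suc p) v = sym (zeroˡ v)
  sumOfSize-const (suc n) zero    v = sumOfSize-const n zero v
  sumOfSize-const (suc n) (suc p) v = trans
    (+-cong (sumOfSize-const n p v) (sumOfSize-const n (suc p) v)) (pascal n p v)

  sumOfSize-zero : ∀ n p → sumOfSize n p (λ _ → 0#) ≈ 0#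
  sumOfSize-zero n p = trans (sumOfSize-const n p 0#) (zeroʳ _)

  -- Only the empty set has size 0, and it does not contain `i`.
  sumOfSize-0-inside : ∀ n i (b : Subset n → Bool) v → sumOfSize n 0 (λ S → when (lookup S i ∧ b S) v) ≈ 0#
  sumOfSize-0-inside (suc n) zero    b v = sumOfSize-zero n 0
  sumOfSize-0-inside (suc n) (suc i) b v = sumOfSize-0-inside n i (b ∘ (outside ∷_)) v

  -- Besides `i`, such a set consists of `p` of the other `n` elements.
  sumOfSize-inside : ∀ n p i v → sumOfSize (suc n) (suc p) (λ S → when (lookup S i) v) ≈ fromℕ (n C p) * v
  sumOfSize-inside n p zero v = trans
    (+-cong (sumOfSize-const n p v) (sumOfSize-zero n (suc p))) (+-identityʳ _)
  sumOfSize-inside (suc n) zero (suc i) v = trans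
    (+-cong (0-inside n i) (sumOfSize-inside n zero i v)) (+-identityˡ _)
    where
    0-inside : ∀ n i → sumOfSize (suc n) 0 (λ S → when (lookup S i) v) ≈ 0#
    0-inside n       zero    = sumOfSize-zero n 0
    0-inside (suc n) (suc i) = 0-inside n i
  sumOfSize-inside (suc n) (suc p) (suc i) v = trans
    (+-cong (sumOfSize-inside n p i v) (sumOfSize-inside n (suc p) i v)) (pascal n p v)

  sumOfSize-outside : ∀ n p j v → sumOfSize (suc n) p (λ S → when (not (lookup S j)) v) ≈ fromℕ (n C p) * v
  sumOfSize-outside n       zero    zero    v = sumOfSize-const n 0 v
  sumOfSize-outside n       (suc p) zero    v = trans
    (+-cong (sumOfSize-zero n p) (sumOfSize-const n (suc p) v)) (+-identityˡ _)
  sumOfSize-outside (suc n) zero    (suc j) v = sumOfSize-outside n zero j v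
  sumOfSize-outside (suc n) (suc p) (suc j) v = trans
    (+-cong (sumOfSize-outside n p j v) (sumOfSize-outside n (suc p) j v)) (pascal n p v)

  -- With `i` in and `j` out, the remaining `p` members are chosen freely among the other `n`
  -- elements. Applied to colours, this counts the dicuts that contain a given arc.
  sumOfSize-separating : ∀ n p {i j} → i ≢ j → ∀ v →
    sumOfSize (suc (suc n)) (suc p) (λ S → when (lookup S i ∧ not (lookup S j)) v) ≈ fromℕ (n C p) * v
  sumOfSize-separating n p {zero}  {zero}  i≢j v = contradiction ≡.refl i≢j
  sumOfSize-separating n p {zero}  {suc j} i≢j v = trans
    (+-cong (sumOfSize-outside n p j v) (sumOfSize-zero (suc n) (suc p))) (+-identityʳ _)
  -- Sets containing the first element contain `j` and contribute nothing; for the others only the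
  -- condition on `i` remains.
  sumOfSize-separating n p {suc i} {zero}  i≢j v = trans
    (+-cong
      (trans (sumOfSize-cong (suc n) p λ S → when-≡ v (∧-zeroʳ (lookup S i))) (sumOfSize-zero (suc n) p))
      (trans (sumOfSize-cong (suc n) (suc p) λ S → when-≡ v (∧-identityʳ (lookup S i))) (sumOfSize-inside n p i v)))
    (+-identityˡ _)
  sumOfSize-separating zero    p {suc zero} {suc zero} i≢j v = contradiction ≡.refl i≢j
  -- Taking the first element uses up the size, leaving no room for `i`.
  sumOfSize-separating (suc n) zero    {suc i} {suc j} i≢j v = trans
    (+-cong (sumOfSize-0-inside (suc (suc n)) i (λ S → not (lookup S j)) v)
            (sumOfSize-separating n zero (i≢j ∘ ≡.cong suc) v))
    (+-identityˡ _)
  sumOfSize-separating (suc n) (suc p) {suc i} {suc j} i≢j v = trans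
    (+-cong (sumOfSize-separating n p (i≢j ∘ ≡.cong suc) v) (sumOfSize-separating n (suc p) (i≢j ∘ ≡.cong suc) v))
    (pascal n p v)

-- Maxima over vertex sets and sums between them.

module _ {c ℓ₁ ℓ₂} {F : OrderedField c ℓ₁ ℓ₂} {n : ℕ} where
  open OrderedField F
  open OrderedFieldProperties F
  open CommutativeRing commutativeRing using
    ( setoid; refl; sym; trans; +-cong; +-congˡ; +-congʳ; +-assoc; +-identityʳ;
      +-group; -‿inverseˡ; -‿inverseʳ; *-cong; *-congˡ; *-congʳ; *-assoc; *-identityˡ;
      zeroʳ; semiring; commutativeSemiring )
  open DecTotalOrder decTotalOrder using (_≟_; total)
    renaming (trans to ≤-trans; reflexive to ≤-reflexive; ≤-respʳ-≈ to ≤-respʳ)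
  open GroupProperties +-group using () renaming (∙-cancelʳ to +-cancelʳ)
  open SemiringSum semiring using (sum-cong-≋; ∑-comm; ∑-distrib-+; *-distribˡ-sum)
  open Extrema totalOrder using (max≤v⁺; xs≤max)
  open SemiringSolver commutativeSemiring using (solve; _:=_; _:+_; _:*_)

  -- Both `macᴰ` and `macᴳ` are definitionally of this form. The seed `g ⊥` is itself a value of
  -- `g`, so it does not alter the maximum.
  maxOverSubsets : (Subset n → Carrier) → Carrier
  maxOverSubsets g = max (g ⊥) (map g (allSubsets n))

  ≤-maxOverSubsets : ∀ g X → g X ≤ maxOverSubsets g
  ≤-maxOverSubsets g X = All.lookup (All.map⁻ (xs≤max (g ⊥) (map g (allSubsets n)))) (∈-allSubsets X)

  maxOverSubsets-least : ∀ g {v} → (∀ X → g X ≤ v) → maxOverSubsets g ≤ v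
  maxOverSubsets-least g g≤v = max≤v⁺ (g≤v ⊥) (All.map⁺ (All.universal g≤v (allSubsets n)))

  lookup-∁ : ∀ (X : Subset n) x → lookup (∁ X) x ≡ not (lookup X x)
  lookup-∁ X x = lookup-map x not X

  sumBetween-empty : ∀ f (X Y : Subset n) → Empty X ⊎ Empty Y → sumBetween {F = F} f X Y ≈ 0#
  sumBetween-empty f X Y empty = sum≈0 λ x → sum≈0 λ y → when-≡ (f x y) (vanishes x y empty)
    where
    lookup-empty : ∀ (Z : Subset n) → Empty Z → ∀ z → lookup Z z ≡ false
    lookup-empty Z Z-empty z with lookup Z z in eq
    ... | true  = contradiction (z , lookup⇒[]= z Z eq) Z-empty
    ... | false = ≡.refl
    vanishes : ∀ x y → Empty X ⊎ Empty Y → lookup X x ∧ lookup Y y ≡ false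
    vanishes x y (inj₁ X-empty) = ≡.cong (_∧ lookup Y y) (lookup-empty X X-empty x)
    vanishes x y (inj₂ Y-empty) = ≡.trans (≡.cong (lookup X x ∧_) (lookup-empty Y Y-empty y)) (∧-zeroʳ _)

  module _ (D : WeightedDigraph F n) where
    open WeightedDigraph D using (arc; w-nonneg)

    private
      a : Fin n → Fin n → Carrier
      a = arcWeight D

      dicut : Subset n → Carrier
      dicut = dicutWeight D

    arcWeight-nonneg : ∀ x y → 0# ≤ a x y
    arcWeight-nonneg x y = extendByZero-nonneg {F = F} (arc x y) w-nonneg

    dicut-nonneg : ∀ X → 0# ≤ dicut X
    dicut-nonneg X = sum-nonneg λ x → sum-nonneg λ y → when-nonneg (lookup X x ∧ lookup (∁ X) y) (arcWeight-nonneg x y)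

    dicut≤mac : ∀ X → dicut X ≤ macᴰ D
    dicut≤mac = ≤-maxOverSubsets dicut

    -- Net outflow, sources and the bound (a).

    netOutflow : Subset n → Carrier
    netOutflow X = sum λ x → when (lookup X x) (r D x)

    -- Each side counts every arc with at least one end in `X` exactly once. Avoiding subtraction
    -- lets the identity be checked arc by arc.
    dicut+inflow≈outflow+dicut-∁ : ∀ X →
      dicut X + sum (λ x → when (lookup X x) (w⁻ D x)) ≈ sum (λ x → when (lookup X x) (w⁺ D x)) + dicut (∁ X)
    dicut+inflow≈outflow+dicut-∁ X = begin
      dicut X + sum (λ x → when (lookup X x) (w⁻ D x))
        ≈⟨ +-congˡ (sum-cong-≋ λ x → when-sum (lookup X x) (λ y → a y x)) ⟩
      dicut X + sum (λ x → sum λ y → when (lookup X x) (a y x))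
        -- After the exchange `x` is the tail and `y` the head in both sums.
        ≈⟨ +-congˡ (∑-comm (λ x y → when (lookup X x) (a y x))) ⟩
      dicut X + sum (λ x → sum λ y → when (lookup X y) (a x y))
        ≈⟨ ∑∑-distrib-+ (λ x y → when (lookup X x ∧ lookup (∁ X) y) (a x y)) (λ x y → when (lookup X y) (a x y)) ⟨
      sum (λ x → sum λ y → when (lookup X x ∧ lookup (∁ X) y) (a x y) + when (lookup X y) (a x y))
        ≈⟨ ∑∑-cong arcwise ⟩
      sum (λ x → sum λ y → when (lookup X x) (a x y) + when (lookup (∁ X) x ∧ lookup (∁ (∁ X)) y) (a x y))
        ≈⟨ ∑∑-distrib-+ (λ x y → when (lookup X x) (a x y))
             (λ x y → when (lookup (∁ X) x ∧ lookup (∁ (∁ X)) y) (a x y)) ⟩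
      sum (λ x → sum λ y → when (lookup X x) (a x y)) + dicut (∁ X)
        ≈⟨ +-congʳ (sum-cong-≋ λ x → when-sum (lookup X x) (a x)) ⟨
      sum (λ x → when (lookup X x) (w⁺ D x)) + dicut (∁ X) ∎
      where
      open ≈-Reasoning setoid
      booleans : ∀ p q v → when (p ∧ not q) v + when q v ≈ when p v + when (not p ∧ not (not q)) v
      booleans true  true  v = +-comm 0# v
      booleans true  false v = refl
      booleans false true  v = refl
      booleans false false v = refl
      arcwise : ∀ x y → when (lookup X x ∧ lookup (∁ X) y) (a x y) + when (lookup X y) (a x y)
                      ≈ when (lookup X x) (a x y) + when (lookup (∁ X) x ∧ lookup (∁ (∁ X)) y) (a x y)
      arcwise x y rewrite lookup-∁ (∁ X) y | lookup-∁ X x | lookup-∁ X y = booleans (lookup X x) (lookup X y) (a x y)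

    dicut≈netOutflow+dicut-∁ : ∀ X → dicut X ≈ netOutflow X + dicut (∁ X)
    dicut≈netOutflow+dicut-∁ X = +-cancelʳ inflow _ _ (begin
      dicut X + inflow ≈⟨ dicut+inflow≈outflow+dicut-∁ X ⟩
      sum (λ x → when (lookup X x) (w⁺ D x)) + dicut (∁ X)
        ≈⟨ +-congʳ (trans
             (sum-cong-≋ λ x → trans (when-cong (lookup X x) (w⁺≈r+w⁻ x)) (when-+ (lookup X x) (r D x) (w⁻ D x)))
             (∑-distrib-+ (λ x → when (lookup X x) (r D x)) (λ x → when (lookup X x) (w⁻ D x)))) ⟩
      (netOutflow X + inflow) + dicut (∁ X)
        ≈⟨ solve 3 (λ x y z → (x :+ y) :+ z := (x :+ z) :+ y) refl (netOutflow X) inflow (dicut (∁ X)) ⟩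
      (netOutflow X + dicut (∁ X)) + inflow ∎)
      where
      open ≈-Reasoning setoid
      inflow : Carrier
      inflow = sum λ x → when (lookup X x) (w⁻ D x)
      w⁺≈r+w⁻ : ∀ x → w⁺ D x ≈ r D x + w⁻ D x
      w⁺≈r+w⁻ x = sym (trans (+-assoc (w⁺ D x) _ _) (trans (+-congˡ (-‿inverseˡ (w⁻ D x))) (+-identityʳ _)))

    -- Termwise, each `r x`, kept or replaced by zero, is at most its positive part.
    netOutflow≤r⁺ : ∀ X → netOutflow X ≤ r⁺ D
    netOutflow≤r⁺ X = sum-mono λ x → positivePart (lookup X x) (r D x)
      where
      positivePart : ∀ b v → when b v ≤ when (does (0# <? v)) v
      positivePart b v with 0# <? v
      positivePart true  v | yes _         = ≤-refl
      positivePart false v | yes (0≤v , _) = 0≤v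
      positivePart false v | no _          = ≤-refl
      -- `_<_` is `_≤_` together with inequality, so if `0# < v` fails, then either `v ≤ 0#` or
      -- `0# ≈ v`.
      positivePart true  v | no 0≮v with total v 0# | 0# ≟ v
      ... | inj₁ v≤0 | _       = v≤0
      ... | inj₂ 0≤v | yes 0≈v = ≤-reflexive (sym 0≈v)
      ... | inj₂ 0≤v | no 0≉v  = contradiction (0≤v , 0≉v) 0≮v

    sources : Subset n
    sources = tabulate λ x → does (0# <? r D x)

    -- The equality case of `netOutflow≤r⁺`: `sources` and `r⁺` use the same Boolean test.
    dicut-sources : dicut sources ≈ r⁺ D + dicut (∁ sources)
    dicut-sources = trans (dicut≈netOutflow+dicut-∁ sources) (+-congʳ (sum-cong-≋ λ x →
      when-≡ (r D x) (lookup∘tabulate (λ x → does (0# <? r D x)) x)))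

    r⁺≤dicut-sources : r⁺ D ≤ dicut sources
    r⁺≤dicut-sources = ≤-resp₂ (+-identityʳ _) (sym dicut-sources) (+-mono-≤ ≤-refl (dicut-nonneg (∁ sources)))

    r⁺≤mac : r⁺ D ≤ macᴰ D
    r⁺≤mac = ≤-trans r⁺≤dicut-sources (dicut≤mac sources)

    r⁺≤0 : Empty sources ⊎ Empty (∁ sources) → r⁺ D ≤ 0#
    r⁺≤0 empty = ≤-respʳ (sumBetween-empty a sources (∁ sources) empty) r⁺≤dicut-sources

    -- The dicut out of `sources` exceeds the reversed dicut by `r⁺ D`, and the reversed one weighs
    -- at least `k` when it is proper.
    r⁺+minDicut≤mac : ∀ k → IsMinProperDicut D k → r⁺ D + k ≤ macᴰ D
    r⁺+minDicut≤mac k ((X₀ , _ , _ , dicut-X₀≈k) , minimal) with nonempty? sources | nonempty? (∁ sources)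
    ... | yes sources≢∅ | yes ∁sources≢∅ = ≤-trans
      (+-mono-≤ ≤-refl (minimal (∁ sources) ∁sources≢∅ (nonempty-∁∁ sources≢∅)))
      (≤-respˡ-≈ dicut-sources (dicut≤mac sources))
      where
      nonempty-∁∁ : Nonempty sources → Nonempty (∁ (∁ sources))
      nonempty-∁∁ (x , x∈) = x , x∉p⇒x∈∁p (x∈p⇒x∉∁p x∈)
    -- When a side is empty, `r⁺ D ≤ 0#`, and the dicut of `X₀` attaining `k` suffices.
    ... | no empty | _ =
      ≤-respʳ (+-identityˡ _) (+-mono-≤ (r⁺≤0 (inj₁ empty)) (≤-respˡ-≈ dicut-X₀≈k (dicut≤mac X₀)))
    ... | yes _ | no empty =
      ≤-respʳ (+-identityˡ _) (+-mono-≤ (r⁺≤0 (inj₂ empty)) (≤-respˡ-≈ dicut-X₀≈k (dicut≤mac X₀)))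

    -- Cuts of the underlying graph and the bounds (b) and (c).

    edgeWeight≈ : ∀ x y → edgeWeight (UG D) x y ≈ a x y + a y x
    edgeWeight≈ x y = cases (arc x y) (arc y x) _ _
      where
      cases : ∀ b b′ (f : T b → Carrier) (f′ : T b′ → Carrier) →
              let s = extendByZero {F = F} b f + extendByZero {F = F} b′ f′ in
              extendByZero {F = F} (b ∨ b′) (λ _ → s) ≈ s
      cases true  b′    f f′ = refl
      cases false true  f f′ = refl
      -- For a non-edge both arc weights are the default `0#`, and so is the edge weight.
      cases false false f f′ = sym (+-identityˡ 0#)

    -- An edge across the cut carries the weights of its forward and backward arcs; the backward
    -- ones make up the opposite dicut.
    cut≈dicut+dicut-∁ : ∀ X → cutWeight (UG D) X ≈ dicut X + dicut (∁ X)
    cut≈dicut+dicut-∁ X = begin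
      cutWeight (UG D) X
        ≈⟨ ∑∑-cong (λ x y → trans (when-cong (b x y) (edgeWeight≈ x y)) (when-+ (b x y) (a x y) (a y x))) ⟩
      sum (λ x → sum λ y → when (b x y) (a x y) + when (b x y) (a y x))
        ≈⟨ ∑∑-distrib-+ (λ x y → when (b x y) (a x y)) (λ x y → when (b x y) (a y x)) ⟩
      dicut X + sum (λ x → sum λ y → when (b x y) (a y x))
        ≈⟨ +-congˡ (trans (∑-comm (λ x y → when (b x y) (a y x)))
             (∑∑-cong λ y x → when-≡ (a y x) (reversed x y))) ⟩
      dicut X + dicut (∁ X) ∎
      where
      open ≈-Reasoning setoid
      b : Fin n → Fin n → Bool
      b x y = lookup X x ∧ lookup (∁ X) y
      reversed : ∀ x y → b x y ≡ lookup (∁ X) y ∧ lookup (∁ (∁ X)) x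
      reversed x y = ≡.trans (∧-comm (lookup X x) _) (≡.cong (lookup (∁ X) y ∧_)
        (≡.sym (≡.trans (lookup-∁ (∁ X) x) (≡.trans (≡.cong not (lookup-∁ X x)) (not-involutive (lookup X x))))))

    half-macᴳ≤macᴰ : macᴳ (UG D) / fromℕ 2 ≤ macᴰ D
    half-macᴳ≤macᴰ = *-cancelˡ-≤ 2 (≤-resp₂ (sym (n*[x/n]≈x 2 _)) (sym (2*x≈x+x _))
      (maxOverSubsets-least (cutWeight (UG D)) λ X →
        ≤-respˡ-≈ (sym (cut≈dicut+dicut-∁ X)) (+-mono-≤ (dicut≤mac X) (dicut≤mac (∁ X)))))

    -- Adding the sum and the difference of two opposite dicuts gives twice the first:
    -- `cutWeight (UG D) X` is the sum, `netOutflow X` the difference.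
    macᴰ≤half : macᴰ D ≤ (macᴳ (UG D) + r⁺ D) / fromℕ 2
    macᴰ≤half = maxOverSubsets-least dicut λ X → *-cancelˡ-≤ 2
      (≤-resp₂ (sym (2*dicut X)) (sym (n*[x/n]≈x 2 _))
        (+-mono-≤ (≤-maxOverSubsets (cutWeight (UG D)) X) (netOutflow≤r⁺ X)))
      where
      open ≈-Reasoning setoid
      2*dicut : ∀ X → fromℕ 2 * dicut X ≈ cutWeight (UG D) X + netOutflow X
      2*dicut X = begin
        fromℕ 2 * dicut X                            ≈⟨ 2*x≈x+x (dicut X) ⟩
        dicut X + dicut X                            ≈⟨ +-congˡ (dicut≈netOutflow+dicut-∁ X) ⟩
        dicut X + (netOutflow X + dicut (∁ X))
          ≈⟨ solve 3 (λ x y z → x :+ (y :+ z) := (x :+ z) :+ y) refl (dicut X) (netOutflow X) (dicut (∁ X)) ⟩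
        (dicut X + dicut (∁ X)) + netOutflow X       ≈⟨ +-congʳ (cut≈dicut+dicut-∁ X) ⟨
        cutWeight (UG D) X + netOutflow X            ∎

    average≤macᴰ : (macᴳ (UG D) / fromℕ 2 + r⁺ D) / fromℕ 2 ≤ macᴰ D
    average≤macᴰ = *-cancelˡ-≤ 2 (≤-resp₂ (sym (n*[x/n]≈x 2 _)) (sym (2*x≈x+x _))
      (+-mono-≤ half-macᴳ≤macᴰ r⁺≤mac))

    -- Colourings and the bounds (d).

    differentlyColoured : ∀ {q} ((f , _) : Colourable (UG D) q) x y → f x ≢ f y ⊎ a x y ≡ 0#
    differentlyColoured (f , proper) x y = cases (arc x y) (λ t → proper x y (Equivalence.from T-∨ (inj₁ t))) _
      where
      cases : ∀ b → (T b → f x ≢ f y) → (g : T b → Carrier) → f x ≢ f y ⊎ extendByZero {F = F} b g ≡ 0#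
      cases true  fx≢fy g = inj₁ (fx≢fy tt)
      cases false _     g = inj₂ ≡.refl

    -- Double counting: `dicut≤mac` is summed over all sets of `suc k` colours, and the left side is
    -- regrouped by arcs. Properness supplies the distinct end colours that `sumOfSize-separating`
    -- needs.
    balancedDicuts-bound : ∀ k → Colourable (UG D) (2 ℕ.+ (k ℕ.+ k)) →
      fromℕ ((k ℕ.+ k) C k) * totalWeight D ≤ fromℕ ((2 ℕ.+ (k ℕ.+ k)) C suc k) * macᴰ D
    balancedDicuts-bound k col@(f , _) = ≤-resp₂ total-dicut (sumOfSize-const q (suc k) (macᴰ D))
      (sumOfSize-mono q (suc k) (λ S → dicut≤mac (X S)))
      where
      open ≈-Reasoning setoid
      q : ℕ
      q = 2 ℕ.+ (k ℕ.+ k)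
      X : Subset q → Subset n
      X S = tabulate (lookup S ∘ f)
      separates : ∀ S x y → lookup (X S) x ∧ lookup (∁ (X S)) y ≡ lookup S (f x) ∧ not (lookup S (f y))
      separates S x y = ≡.cong₂ _∧_ (lookup∘tabulate (lookup S ∘ f) x)
        (≡.trans (lookup-∁ (X S) y) (≡.cong not (lookup∘tabulate (lookup S ∘ f) y)))
      onArc : ∀ x y → sumOfSize q (suc k) (λ S → when (lookup S (f x) ∧ not (lookup S (f y))) (a x y))
                    ≈ fromℕ ((k ℕ.+ k) C k) * a x y
      onArc x y with differentlyColoured col x y
      ... | inj₁ fx≢fy = sumOfSize-separating (k ℕ.+ k) k fx≢fy (a x y)
      -- Non-adjacent pairs may share a colour, but then both sides vanish.
      ... | inj₂ a≡0 rewrite a≡0 = trans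
        (sumOfSize-cong q (suc k) (λ S → when-zero (lookup S (f x) ∧ not (lookup S (f y)))))
        (trans (sumOfSize-zero q (suc k)) (sym (zeroʳ _)))
        where
        when-zero : ∀ b → when b 0# ≈ 0#
        when-zero true  = refl
        when-zero false = refl
      total-dicut : sumOfSize q (suc k) (λ S → dicut (X S)) ≈ fromℕ ((k ℕ.+ k) C k) * totalWeight D
      total-dicut = begin
        sumOfSize q (suc k) (λ S → dicut (X S))
          ≈⟨ sumOfSize-cong q (suc k) (λ S → ∑∑-cong λ x y → when-≡ (a x y) (separates S x y)) ⟩
        sumOfSize q (suc k) (λ S → sum λ x → sum λ y → when (lookup S (f x) ∧ not (lookup S (f y))) (a x y))
          ≈⟨ sumOfSize-sum q (suc k) (λ x S → sum λ y → when (lookup S (f x) ∧ not (lookup S (f y))) (a x y)) ⟩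
        sum (λ x → sumOfSize q (suc k) (λ S → sum λ y → when (lookup S (f x) ∧ not (lookup S (f y))) (a x y)))
          ≈⟨ sum-cong-≋ (λ x → sumOfSize-sum q (suc k) (λ y S → when (lookup S (f x) ∧ not (lookup S (f y))) (a x y))) ⟩
        sum (λ x → sum λ y → sumOfSize q (suc k) (λ S → when (lookup S (f x) ∧ not (lookup S (f y))) (a x y)))
          ≈⟨ ∑∑-cong onArc ⟩
        sum (λ x → sum λ y → B * a x y)
          ≈⟨ sum-cong-≋ (λ x → *-distribˡ-sum B (a x)) ⟨
        sum (λ x → B * sum (a x))
          ≈⟨ *-distribˡ-sum B (λ x → sum (a x)) ⟨
        B * totalWeight D ∎
        where
        B : Carrier
        B = fromℕ ((k ℕ.+ k) C k)

    -- N stands for the two forms of 2k + 1 in the theorem, since ⁻¹ is not assumed to respect ≈.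
    evenColouring-bound : ∀ k → Colourable (UG D) (2 ℕ.+ (k ℕ.+ k)) → ∀ {N} → N ≈ fromℕ (suc (k ℕ.+ k)) →
      (1# / fromℕ 4 + 1# / (fromℕ 4 * N)) * totalWeight D ≤ macᴰ D
    -- The factor 4(2k+1)C(2k, k) clears all denominators: the left coefficient becomes (2k+2)C(2k,
    -- k), and the right one is 2(k+1)C(2k+2, k+1) by `centralC-step`. So the claim is
    -- `balancedDicuts-bound` scaled by 2(k+1).
    evenColouring-bound k col {N} N≈ = *-cancelˡ-≤ (4 ℕ.* N′ ℕ.* b) (≤-resp₂ (sym lhs) rhs
      (*-monoˡ-≤ (fromℕ-nonneg (2 ℕ.* suc k)) (balancedDicuts-bound k col)))
      where
      open ≈-Reasoning setoid
      N′ b : ℕ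
      N′ = suc (k ℕ.+ k)
      b = (k ℕ.+ k) C k
      instance
        b≢0 : NonZero b
        b≢0 = nCk-nonZero (ℕ.m≤m+n k k)
        4N′b≢0 : NonZero (4 ℕ.* N′ ℕ.* b)
        4N′b≢0 = ℕ.m*n≢0 (4 ℕ.* N′) b
      W = totalWeight D
      Q = fromℕ 4
      B = fromℕ b
      u = Q ⁻¹
      t = (Q * N) ⁻¹
      4N≈ : Q * N ≈ fromℕ (4 ℕ.* N′)
      4N≈ = trans (*-congˡ N≈) (sym (fromℕ-homo-* 4 N′))
      4N≉0 : ¬ (Q * N ≈ 0#)
      4N≉0 4N≈0 = fromℕ≉0 (4 ℕ.* N′) (trans (sym 4N≈) 4N≈0)
      lhs : fromℕ (4 ℕ.* N′ ℕ.* b) * ((1# * u + 1# * t) * W) ≈ fromℕ (2 ℕ.* suc k) * (B * W)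
      lhs = begin
        fromℕ (4 ℕ.* N′ ℕ.* b) * ((1# * u + 1# * t) * W)
          ≈⟨ *-cong (trans (fromℕ-homo-* (4 ℕ.* N′) b) (*-congʳ (sym 4N≈)))
               (*-congʳ (+-cong (*-identityˡ u) (*-identityˡ t))) ⟩
        (Q * N) * B * ((u + t) * W)
          ≈⟨ solve 6 (λ q n b u t w → (q :* n) :* b :* ((u :+ t) :* w) := ((q :* u) :* n :+ (q :* n) :* t) :* (b :* w))
               refl Q N B u t W ⟩
        ((Q * u) * N + (Q * N) * t) * (B * W)
          ≈⟨ *-congʳ (+-cong (trans (*-congʳ (⁻¹-inverse Q (fromℕ≉0 4))) (trans (*-identityˡ N) N≈))
               (⁻¹-inverse (Q * N) 4N≉0)) ⟩
        (fromℕ N′ + 1#) * (B * W)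
          ≈⟨ *-congʳ (+-comm (fromℕ N′) 1#) ⟩
        fromℕ (suc N′) * (B * W)
          ≡⟨ ≡.cong (λ m → fromℕ m * (B * W)) 1+N′≡2*[1+k] ⟩
        fromℕ (2 ℕ.* suc k) * (B * W) ∎
        where
        1+N′≡2*[1+k] : suc N′ ≡ 2 ℕ.* suc k
        1+N′≡2*[1+k] = ≡.trans (≡.cong suc (≡.sym (ℕ.+-suc k k))) (≡.sym (≡.cong (suc k ℕ.+_) (ℕ.+-identityʳ (suc k))))
      rhs : fromℕ (2 ℕ.* suc k) * (fromℕ ((2 ℕ.+ (k ℕ.+ k)) C suc k) * macᴰ D) ≈ fromℕ (4 ℕ.* N′ ℕ.* b) * macᴰ D
      rhs = begin
        fromℕ (2 ℕ.* suc k) * (fromℕ c₂ * macᴰ D) ≈⟨ *-assoc _ _ _ ⟨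
        fromℕ (2 ℕ.* suc k) * fromℕ c₂ * macᴰ D   ≈⟨ *-congʳ (fromℕ-homo-* (2 ℕ.* suc k) c₂) ⟨
        fromℕ (2 ℕ.* suc k ℕ.* c₂) * macᴰ D       ≡⟨ ≡.cong (λ m → fromℕ m * macᴰ D) count ⟩
        fromℕ (4 ℕ.* N′ ℕ.* b) * macᴰ D           ∎
        where
        c₂ : ℕ
        c₂ = (2 ℕ.+ (k ℕ.+ k)) C suc k
        count : 2 ℕ.* suc k ℕ.* c₂ ≡ 4 ℕ.* N′ ℕ.* b
        count = ≡.trans (ℕ.*-assoc 2 (suc k) c₂) (≡.trans (≡.cong (2 ℕ.*_) (centralC-step k))
          (≡.trans (≡.sym (ℕ.*-assoc 2 (2 ℕ.* N′) b)) (≡.cong (ℕ._* b) (≡.sym (ℕ.*-assoc 2 2 N′)))))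

    colourable-suc : ∀ {q} → Colourable (UG D) q → Colourable (UG D) (suc q)
    colourable-suc (f , proper) = suc ∘ f , λ x y e → proper x y e ∘ suc-injective

    colourable-0 : Colourable (UG D) 0 → totalWeight D ≈ 0#
    colourable-0 (f , _) = sum≈0 λ x → noColour (f x)
      where
      noColour : ∀ {x} → Fin 0 → x ≈ 0#
      noColour ()

    evenChromatic-bound : ∀ χ → Colourable (UG D) χ → 2 ∣ χ →
      (1# / fromℕ 4 + 1# / (fromℕ 4 * (fromℕ χ - 1#))) * totalWeight D ≤ macᴰ D
    -- Zero is even too: without colours there are no vertices, the total weight vanishes, and the
    -- bound reads 0 ≤ mac(D).
    evenChromatic-bound _ col (divides zero    ≡.refl) = ≤-respˡ-≈
      (sym (trans (*-congˡ (colourable-0 col)) (zeroʳ _)))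
      (≤-trans (dicut-nonneg ⊥) (dicut≤mac ⊥))
    -- Here `χ` is 2k + 2, and the last argument identifies `fromℕ χ - 1#` with 2k + 1.
    evenChromatic-bound _ col (divides (suc k) ≡.refl) rewrite m*2≡m+m k = evenColouring-bound k col
      (trans (+-congʳ (+-comm 1# N)) (trans (+-assoc N 1# (- 1#)) (trans (+-congˡ (-‿inverseʳ 1#)) (+-identityʳ N))))
      where N = fromℕ (suc (k ℕ.+ k))

    oddChromatic-bound : ∀ χ → Colourable (UG D) χ → ¬ (2 ∣ χ) →
      (1# / fromℕ 4 + 1# / (fromℕ 4 * fromℕ χ)) * totalWeight D ≤ macᴰ D
    oddChromatic-bound χ col 2∤χ with even⊎odd χ
    ... | k , inj₁ χ≡k+k  = contradiction (divides k (≡.trans χ≡k+k (≡.sym (m*2≡m+m k)))) 2∤χ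
    -- The extra colour makes 2k + 2 colours, so the denominator 2k + 1 is `χ` itself.
    ... | k , inj₂ ≡.refl = evenColouring-bound k (colourable-suc col) refl

mainTheorem1 :
  ∀ {c ℓ₁ ℓ₂} (F : OrderedField c ℓ₁ ℓ₂) (n : ℕ) (D : WeightedDigraph F n) →
  let open OrderedField F
      G = UG D
      two = fromℕ 2
      four = fromℕ 4
  in
    (2 ≤ℕ n → ∀ k → IsMinProperDicut D k → r⁺ D + k ≤ macᴰ D)
  × (macᴳ G / two ≤ macᴰ D × macᴰ D ≤ (macᴳ G + r⁺ D) / two)
  × ((macᴳ G / two + r⁺ D) / two ≤ macᴰ D × macᴰ D ≤ (macᴳ G + r⁺ D) / two)
  × (∀ (χ : ℕ) → IsChromaticNumber G χ →
        (2 ∣ χ →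
          (1# / four + 1# / (four * (fromℕ χ - 1#))) * totalWeight D ≤ macᴰ D)
      × (¬ (2 ∣ χ) →
          (1# / four + 1# / (four * fromℕ χ)) * totalWeight D ≤ macᴰ D))
mainTheorem1 F n D =
    (λ _ → r⁺+minDicut≤mac D)
  , (half-macᴳ≤macᴰ D , macᴰ≤half D)
  , (average≤macᴰ D , macᴰ≤half D)
  , λ χ (colourable , _) → evenChromatic-bound D χ colourable , oddChromatic-bound D χ colourable
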